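{- The monoid $\overline{\mathbb{M}}_1$ of pseudo-Dyck paths with the product $\ast$ is free on the generators $(w,1,0)$, where $w$ runs over the set of all Dyck paths (of any size $\geq 0$), together with the element $(0,1)$.
   Context: A Dyck path of size $n\geq 0$ is a word of length $2n$ in the letters $0,1$ with $n$ letters $1$ and $n$ letters $0$ such that every prefix contains at least as many $1$'s as $0$'s. A pseudo-Dyck path is a word obtained from a non-empty Dyck path by removing its first letter (a $1$) and its last letter (a $0$). The height after a prefix of a pseudo-Dyck path is its number of $1$'s minus its number of $0$'s (starting at $0$; it may reach $-1$). Product $\ast$: let $u,v$ be pseudo-Dyck paths. Write $u=(u',0^k)$ where $u'$ is empty (if $u$ is empty) or ends with the letter $1$. Write $v=v'v''$ where $v'$ is the largest prefix of $v$ in which the height stays $\geq 0$. Then $u\ast v=(u',v',0^k,v'')$, which is again a pseudo-Dyck path. This product is associative with the empty path as unit, and the resulting monoid is $\overline{\mathbb{M}}_1$. -}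

module Defs where

open import Algebra.Bundles using (Monoid)
open import Algebra.Morphism.Structures using (module MonoidMorphisms)
open import Data.Empty using (⊥; ⊥-elim)
open import Data.List.Base
  using (List; []; _∷_; [_]; _++_; _∷ʳ_; ++-[]-rawMonoid; foldr; filter; inits; length;
         replicate)
open import Data.List.Properties
  using (++-assoc; ++-identityʳ; ++-monoid)
open import Data.List.Relation.Unary.All as All using (All; []; _∷_)
open import Data.List.Relation.Unary.All.Properties using (map⁺; map⁻)
open import Data.Nat.Base using (ℕ; zero; suc; _+_; _≤_; z≤n; s≤s)
open import Data.Nat.Properties
  using (≤-refl; ≤-irrelevant; ≡-irrelevant; +-suc; +-identityʳ; suc-injective; ≤-pred;
         ≤-trans; <-irrefl; m≤n+m)
open import Data.Product.Base using (_×_; _,_; proj₁; proj₂; map₁; ∃-syntax)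
open import Data.Sum.Base using (_⊎_; inj₁; inj₂)
open import Data.Unit.Base using (⊤; tt)
open import Level using (Level; 0ℓ)
open import Relation.Binary.Definitions using (DecidableEquality)
open import Relation.Binary.PropositionalEquality
  using (_≡_; refl; sym; trans; cong; cong₂; subst; isEquivalence; module ≡-Reasoning)
open import Relation.Nullary.Decidable.Core using (yes; no)
open import Tactic.MonoidSolver using (solve)

------------------------------------------------------------------------
-- Dyck and pseudo-Dyck paths

data Bit : Set where
  0b 1b : Bit

infix 4 _≟_

_≟_ : DecidableEquality Bit
0b ≟ 0b = yes refl
0b ≟ 1b = no λ ()
1b ≟ 0b = no λ ()
1b ≟ 1b = yes refl

Word : Set
Word = List Bit

#[_] : Bit → Word → ℕ
#[ b ] w = length (filter (_≟ b) w)

IsDyck : Word → Set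
IsDyck w = #[ 1b ] w ≡ #[ 0b ] w × All (λ p → #[ 0b ] p ≤ #[ 1b ] p) (inits w)

-- A non-empty Dyck path begins with 1 and ends with 0, so every non-empty Dyck
-- path has the form 1b ∷ p ∷ʳ 0b.
IsPseudoDyck : Word → Set
IsPseudoDyck p = IsDyck (1b ∷ p ∷ʳ 0b)

record DyckPath : Set where
  constructor _,_
  field
    word   : Word
    isDyck : IsDyck word

record PseudoDyckPath : Set where
  constructor _,_
  field
    word         : Word
    isPseudoDyck : IsPseudoDyck word

IsDyck-irrelevant : ∀ {w} (p q : IsDyck w) → p ≡ q
IsDyck-irrelevant (p , ps) (q , qs) =
  cong₂ _,_ (≡-irrelevant p q) (All.irrelevant ≤-irrelevant ps qs)

PseudoDyckPath-≡ : ∀ {p q : PseudoDyckPath} →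
                   PseudoDyckPath.word p ≡ PseudoDyckPath.word q → p ≡ q
PseudoDyckPath-≡ {w , p} {w , q} refl = cong (w ,_) (IsDyck-irrelevant p q)

------------------------------------------------------------------------
-- The product on words

0^ : ℕ → Word
0^ k = replicate k 0b

-- splitZeros u = (u′ , k) where u = u′ ++ 0^ k with k as large as possible.
consZeros : Bit → Word × ℕ → Word × ℕ
consZeros 0b ([]    , k) = [] , suc k
consZeros 0b (x ∷ a , k) = 0b ∷ x ∷ a , k
consZeros 1b (a     , k) = 1b ∷ a , k

splitZeros : Word → Word × ℕ
splitZeros = foldr consZeros ([] , 0)

-- splitNonneg h v = (v′ , v″) where v = v′ ++ v″ and v′ is the largest prefix
-- of v staying at height ≥ 0 when started at height h.
splitNonneg : ℕ → Word → Word × Word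
splitNonneg h       []       = [] , []
splitNonneg h       (1b ∷ v) = map₁ (1b ∷_) (splitNonneg (suc h) v)
splitNonneg (suc h) (0b ∷ v) = map₁ (0b ∷_) (splitNonneg h v)
splitNonneg zero    (0b ∷ v) = [] , 0b ∷ v

infixr 7 _⋆_ _∗_

_⋆_ : Word → Word → Word
u ⋆ v = let (u′ , k) = splitZeros u ; (v′ , v″) = splitNonneg 0 v in
        u′ ++ v′ ++ 0^ k ++ v″

------------------------------------------------------------------------
-- Walk i w j: started at height i, the word w stays at height ≥ 0 and ends
-- at height j.

data Walk : ℕ → Word → ℕ → Set where
  []   : ∀ {i} → Walk i [] i
  up   : ∀ {i w j} → Walk (suc i) w j → Walk i (1b ∷ w) j
  down : ∀ {i w j} → Walk i w j → Walk (suc i) (0b ∷ w) j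

walk-++ : ∀ {i j k u v} → Walk i u j → Walk j v k → Walk i (u ++ v) k
walk-++ []       q = q
walk-++ (up p)   q = up (walk-++ p q)
walk-++ (down p) q = down (walk-++ p q)

walk-++⁻ : ∀ {i k} u {v} → Walk i (u ++ v) k → ∃[ j ] Walk i u j × Walk j v k
walk-++⁻ []       p        = _ , [] , p
walk-++⁻ (_ ∷ u) (up p)   = let (j , q , r) = walk-++⁻ u p in j , up q , r
walk-++⁻ (_ ∷ u) (down p) = let (j , q , r) = walk-++⁻ u p in j , down q , r

walk-lift : ∀ {i j w} h → Walk i w j → Walk (i + h) w (j + h)
walk-lift h []       = []
walk-lift h (up p)   = up (walk-lift h p)
walk-lift h (down p) = down (walk-lift h p)

-- Inserting a Dyck path into a walk.
walk-insert : ∀ {i j} u {d v} → Walk 0 d 0 → Walk i (u ++ v) j → Walk i (u ++ d ++ v) j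
walk-insert u d p =
  let (h , q , r) = walk-++⁻ u p in walk-++ q (walk-++ (walk-lift h d) r)

walk⇒count : ∀ {i w j} → Walk i w j →
             i + #[ 1b ] w ≡ j + #[ 0b ] w ×
             All (λ p → #[ 0b ] p ≤ i + #[ 1b ] p) (inits w)
walk⇒count [] = refl , z≤n ∷ []
walk⇒count {i} (up p) =
  let (e , a) = walk⇒count p in
  trans (+-suc i _) e ,
  z≤n ∷ map⁺ (All.map (λ {q} → subst (#[ 0b ] q ≤_) (sym (+-suc i _))) a)
walk⇒count {j = j} (down p) =
  let (e , a) = walk⇒count p in
  trans (cong suc e) (sym (+-suc j _)) , z≤n ∷ map⁺ (All.map s≤s a)

count⇒walk : ∀ i w j → i + #[ 1b ] w ≡ j + #[ 0b ] w →
             All (λ p → #[ 0b ] p ≤ i + #[ 1b ] p) (inits w) → Walk i w j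
count⇒walk i [] j e _ =
  subst (Walk i []) (trans (sym (+-identityʳ i)) (trans e (+-identityʳ j))) []
count⇒walk i (1b ∷ w) j e (_ ∷ a) =
  up (count⇒walk (suc i) w j (trans (sym (+-suc i _)) e)
       (All.map (λ {q} → subst (#[ 0b ] q ≤_) (+-suc i _)) (map⁻ {xs = inits w} a)))
count⇒walk zero    (0b ∷ w) j e (_ ∷ () ∷ _)
count⇒walk (suc i) (0b ∷ w) j e (_ ∷ a) =
  down (count⇒walk i w j (suc-injective (trans e (+-suc j _)))
         (All.map ≤-pred (map⁻ {xs = inits w} a)))

dyck⇒walk : ∀ {w} → IsDyck w → Walk 0 w 0
dyck⇒walk {w} (e , a) = count⇒walk 0 w 0 e a

walk⇒dyck : ∀ {w} → Walk 0 w 0 → IsDyck w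
walk⇒dyck = walk⇒count

pseudo⇒walk : ∀ {w} → IsPseudoDyck w → Walk 1 w 1
pseudo⇒walk {w} d with dyck⇒walk d
... | up p with walk-++⁻ w p
...   | _ , q , down [] = q

walk⇒pseudo : ∀ {w} → Walk 1 w 1 → IsPseudoDyck w
walk⇒pseudo p = walk⇒dyck (up (walk-++ p (down [])))

------------------------------------------------------------------------
-- The product preserves pseudo-Dyck paths

splitZeros-++ : ∀ w → let (a , k) = splitZeros w in a ++ 0^ k ≡ w
splitZeros-++ []       = refl
splitZeros-++ (1b ∷ w) = cong (1b ∷_) (splitZeros-++ w)
splitZeros-++ (0b ∷ w) with splitZeros w | splitZeros-++ w
... | []    , k | e = cong (0b ∷_) e
... | x ∷ a , k | e = cong (0b ∷_) e

splitNonneg-++ : ∀ h v → let (a , b) = splitNonneg h v in a ++ b ≡ v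
splitNonneg-++ h       []       = refl
splitNonneg-++ h       (1b ∷ v) = cong (1b ∷_) (splitNonneg-++ (suc h) v)
splitNonneg-++ (suc h) (0b ∷ v) = cong (0b ∷_) (splitNonneg-++ h v)
splitNonneg-++ zero    (0b ∷ v) = refl

splitNonneg-walk : ∀ h v → Walk (suc h) v 1 →
                   let (a , b) = splitNonneg h v in Walk h a 0 × Walk 1 b 1
splitNonneg-walk h       []       []       = [] , []
splitNonneg-walk h       (1b ∷ v) (up p)   =
  let (q , r) = splitNonneg-walk (suc h) v p in up q , r
splitNonneg-walk (suc h) (0b ∷ v) (down p) =
  let (q , r) = splitNonneg-walk h v p in down q , r
splitNonneg-walk zero    (0b ∷ v) p        = [] , p

⋆-walk : ∀ u v → Walk 1 u 1 → Walk 1 v 1 → Walk 1 (u ⋆ v) 1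
⋆-walk u v p q =
  let (a , k) = splitZeros u
      (b , c) = splitNonneg 0 v
      (r , s) = splitNonneg-walk 0 v q
      p′      = subst (λ w → Walk 1 w 1) (sym (splitZeros-++ u)) p
  in subst (λ w → Walk 1 w 1) (assoc a b (0^ k) c) (walk-++ (walk-insert a r p′) s)
  where
  assoc : ∀ a b z c → (a ++ b ++ z) ++ c ≡ a ++ b ++ z ++ c
  assoc a b z c = solve (++-monoid Bit)

_∗_ : PseudoDyckPath → PseudoDyckPath → PseudoDyckPath
(u , p) ∗ (v , q) = u ⋆ v , walk⇒pseudo (⋆-walk u v (pseudo⇒walk p) (pseudo⇒walk q))

ε : PseudoDyckPath
ε = [] , walk⇒pseudo []

------------------------------------------------------------------------
-- Monoid laws

data StartsWithout1 : Word → Set where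
  []   : StartsWithout1 []
  0b∷_ : ∀ w → StartsWithout1 (0b ∷ w)

splitNonneg-stops : ∀ h v → StartsWithout1 (proj₂ (splitNonneg h v))
splitNonneg-stops h       []       = []
splitNonneg-stops h       (1b ∷ v) = splitNonneg-stops (suc h) v
splitNonneg-stops (suc h) (0b ∷ v) = splitNonneg-stops h v
splitNonneg-stops zero    (0b ∷ v) = 0b∷ v

splitNonneg-unique : ∀ {h a b} → Walk h a 0 → StartsWithout1 b →
                     splitNonneg h (a ++ b) ≡ (a , b)
splitNonneg-unique []       []      = refl
splitNonneg-unique []       (0b∷ _) = refl
splitNonneg-unique (up p)   s       = cong (map₁ (1b ∷_)) (splitNonneg-unique p s)
splitNonneg-unique (down p) s       = cong (map₁ (0b ∷_)) (splitNonneg-unique p s)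

splitZeros-0^ : ∀ k → splitZeros (0^ k) ≡ ([] , k)
splitZeros-0^ zero    = refl
splitZeros-0^ (suc k) rewrite splitZeros-0^ k = refl

splitZeros-unique : ∀ a k → splitZeros (a ++ 1b ∷ 0^ k) ≡ (a ++ [ 1b ] , k)
splitZeros-unique []            k rewrite splitZeros-0^ k = refl
splitZeros-unique (1b ∷ a)      k rewrite splitZeros-unique a k = refl
splitZeros-unique (0b ∷ [])     k rewrite splitZeros-0^ k = refl
splitZeros-unique (0b ∷ a@(_ ∷ _)) k rewrite splitZeros-unique a k = refl

data ZerosView : Word → Set where
  zeros : ∀ k → ZerosView (0^ k)
  last1 : ∀ a k → ZerosView (a ++ 1b ∷ 0^ k)

zerosView : ∀ w → ZerosView w
zerosView []       = zeros 0
zerosView (b ∷ w)  with zerosView w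
zerosView (0b ∷ _) | zeros k   = zeros (suc k)
zerosView (1b ∷ _) | zeros k   = last1 [] k
zerosView (b ∷ _)  | last1 a k = last1 (b ∷ a) k

walk-0^ : ∀ {i j} k → Walk i (0^ k) j → i ≡ k + j
walk-0^ zero    []       = refl
walk-0^ (suc k) (down p) = cong suc (walk-0^ k p)

data LeftView : Word → Set where
  []    : LeftView []
  last1 : ∀ a k → LeftView (a ++ 1b ∷ 0^ k)

leftView : ∀ {i j w} → i ≤ j → Walk i w j → LeftView w
leftView {w = w} i≤j p with zerosView w
... | last1 a k     = last1 a k
... | zeros zero    = []
... | zeros (suc k) = ⊥-elim (absurd k i≤j (walk-0^ (suc k) p))
  where
  absurd : ∀ {i j} k → i ≤ j → i ≡ suc k + j → ⊥
  absurd {j = j} k le refl = <-irrefl refl (≤-trans (s≤s (m≤n+m j k)) le)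

data RightView : Word → Set where
  split : ∀ {a b} → Walk 0 a 0 → StartsWithout1 b → Walk 1 b 1 → RightView (a ++ b)

rightView : ∀ {v} → Walk 1 v 1 → RightView v
rightView {v} p =
  let (q , r) = splitNonneg-walk 0 v p in
  subst RightView (splitNonneg-++ 0 v) (split q (splitNonneg-stops 0 v) r)

⋆-split : ∀ a k {e f} → Walk 0 e 0 → StartsWithout1 f →
          (a ++ 1b ∷ 0^ k) ⋆ (e ++ f) ≡ (a ++ [ 1b ]) ++ e ++ 0^ k ++ f
⋆-split a k p s rewrite splitZeros-unique a k | splitNonneg-unique p s = refl

⋆-identityˡ : ∀ v → [] ⋆ v ≡ v
⋆-identityˡ v = splitNonneg-++ 0 v

⋆-identityʳ : ∀ u → u ⋆ [] ≡ u
⋆-identityʳ u = let (a , k) = splitZeros u in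
  trans (cong (a ++_) (++-identityʳ (0^ k))) (splitZeros-++ u)

0^-+ : ∀ k l → 0^ k ++ 0^ l ≡ 0^ (k + l)
0^-+ zero    l = refl
0^-+ (suc k) l = cong (0b ∷_) (0^-+ k l)

⋆-assoc : ∀ u v w → Walk 1 u 1 → Walk 1 v 1 → Walk 1 w 1 →
          (u ⋆ v) ⋆ w ≡ u ⋆ (v ⋆ w)
⋆-assoc u v w p q r with leftView ≤-refl p | rightView q | rightView r
... | [] | _ | _ =
  trans (cong (_⋆ w) (⋆-identityˡ v)) (sym (⋆-identityˡ (v ⋆ w)))
... | last1 a k | split {x} {y} X Y Y′ | split {e} {f} E F _ = lemma Y Y′
  where
  open ≡-Reasoning
  lemma : ∀ {y} → StartsWithout1 y → Walk 1 y 1 →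
          ((a ++ 1b ∷ 0^ k) ⋆ (x ++ y)) ⋆ (e ++ f) ≡
          (a ++ 1b ∷ 0^ k) ⋆ ((x ++ y) ⋆ (e ++ f))
  lemma [] _ with leftView z≤n X
  ... | [] = trans (cong (_⋆ (e ++ f)) (⋆-identityʳ (a ++ 1b ∷ 0^ k)))
                   (cong ((a ++ 1b ∷ 0^ k) ⋆_) (sym (⋆-identityˡ (e ++ f))))
  ... | last1 d l = begin
    ((a ++ 1b ∷ 0^ k) ⋆ ((d ++ 1b ∷ 0^ l) ++ [])) ⋆ (e ++ f)
      ≡⟨ cong (_⋆ (e ++ f)) (⋆-split a k X []) ⟩
    ((a ++ [ 1b ]) ++ (d ++ [ 1b ] ++ 0^ l) ++ 0^ k ++ []) ⋆ (e ++ f)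
      ≡⟨ cong (_⋆ (e ++ f)) (assoc₁ [ 1b ] (0^ l) (0^ k)) ⟩
    (((a ++ [ 1b ]) ++ d) ++ [ 1b ] ++ 0^ l ++ 0^ k) ⋆ (e ++ f)
      ≡⟨ cong (λ z → (((a ++ [ 1b ]) ++ d) ++ [ 1b ] ++ z) ⋆ (e ++ f)) (0^-+ l k) ⟩
    (((a ++ [ 1b ]) ++ d) ++ 1b ∷ 0^ (l + k)) ⋆ (e ++ f)
      ≡⟨ ⋆-split ((a ++ [ 1b ]) ++ d) (l + k) E F ⟩
    (((a ++ [ 1b ]) ++ d) ++ [ 1b ]) ++ e ++ 0^ (l + k) ++ f
      ≡⟨ cong (λ z → (((a ++ [ 1b ]) ++ d) ++ [ 1b ]) ++ e ++ z ++ f) (sym (0^-+ l k)) ⟩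
    (((a ++ [ 1b ]) ++ d) ++ [ 1b ]) ++ e ++ (0^ l ++ 0^ k) ++ f
      ≡⟨ assoc₂ [ 1b ] (0^ l) (0^ k) ⟩
    (a ++ [ 1b ]) ++ ((d ++ [ 1b ]) ++ e ++ 0^ l) ++ 0^ k ++ f
      ≡⟨ ⋆-split a k D F ⟨
    (a ++ 1b ∷ 0^ k) ⋆ (((d ++ [ 1b ]) ++ e ++ 0^ l) ++ f)
      ≡⟨ cong ((a ++ 1b ∷ 0^ k) ⋆_) (assoc₃ (d ++ [ 1b ]) (0^ l)) ⟩
    (a ++ 1b ∷ 0^ k) ⋆ ((d ++ [ 1b ]) ++ e ++ 0^ l ++ f)
      ≡⟨ cong ((a ++ 1b ∷ 0^ k) ⋆_) (⋆-split d l E F) ⟨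
    (a ++ 1b ∷ 0^ k) ⋆ ((d ++ 1b ∷ 0^ l) ⋆ (e ++ f))
      ≡⟨ cong (λ z → (a ++ 1b ∷ 0^ k) ⋆ (z ⋆ (e ++ f))) (++-identityʳ (d ++ 1b ∷ 0^ l)) ⟨
    (a ++ 1b ∷ 0^ k) ⋆ (((d ++ 1b ∷ 0^ l) ++ []) ⋆ (e ++ f)) ∎
    where
    D : Walk 0 ((d ++ [ 1b ]) ++ e ++ 0^ l) 0
    D = walk-insert (d ++ [ 1b ]) E
          (subst (λ z → Walk 0 z 0) (sym (++-assoc d [ 1b ] (0^ l))) X)
    assoc₁ : ∀ o m n → (a ++ o) ++ (d ++ o ++ m) ++ n ++ [] ≡ ((a ++ o) ++ d) ++ o ++ m ++ n
    assoc₁ o m n = solve (++-monoid Bit)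
    assoc₂ : ∀ o m n → (((a ++ o) ++ d) ++ o) ++ e ++ (m ++ n) ++ f ≡
                       (a ++ o) ++ ((d ++ o) ++ e ++ m) ++ n ++ f
    assoc₂ o m n = solve (++-monoid Bit)
    assoc₃ : ∀ c m → (c ++ e ++ m) ++ f ≡ c ++ e ++ m ++ f
    assoc₃ c m = solve (++-monoid Bit)
  lemma (0b∷ y) (down Y) with leftView z≤n Y
  ... | last1 d l = begin
    ((a ++ 1b ∷ 0^ k) ⋆ (x ++ 0b ∷ d ++ 1b ∷ 0^ l)) ⋆ (e ++ f)
      ≡⟨ cong (_⋆ (e ++ f)) (⋆-split a k X (0b∷ _)) ⟩
    ((a ++ [ 1b ]) ++ x ++ 0^ k ++ 0b ∷ d ++ [ 1b ] ++ 0^ l) ⋆ (e ++ f)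
      ≡⟨ cong (_⋆ (e ++ f)) (assoc₁ (a ++ [ 1b ]) (0^ k) (0b ∷ d) ([ 1b ] ++ 0^ l)) ⟩
    (((a ++ [ 1b ]) ++ x ++ 0^ k ++ 0b ∷ d) ++ 1b ∷ 0^ l) ⋆ (e ++ f)
      ≡⟨ ⋆-split ((a ++ [ 1b ]) ++ x ++ 0^ k ++ 0b ∷ d) l E F ⟩
    (((a ++ [ 1b ]) ++ x ++ 0^ k ++ 0b ∷ d) ++ [ 1b ]) ++ e ++ 0^ l ++ f
      ≡⟨ assoc₂ (a ++ [ 1b ]) (0^ k) (0b ∷ d) [ 1b ] (0^ l) ⟩
    (a ++ [ 1b ]) ++ x ++ 0^ k ++ 0b ∷ (d ++ [ 1b ]) ++ e ++ 0^ l ++ f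
      ≡⟨ ⋆-split a k X (0b∷ _) ⟨
    (a ++ 1b ∷ 0^ k) ⋆ (x ++ 0b ∷ (d ++ [ 1b ]) ++ e ++ 0^ l ++ f)
      ≡⟨ cong ((a ++ 1b ∷ 0^ k) ⋆_) (assoc₃ (0b ∷ d) [ 1b ] (0^ l)) ⟩
    (a ++ 1b ∷ 0^ k) ⋆ (((x ++ 0b ∷ d) ++ [ 1b ]) ++ e ++ 0^ l ++ f)
      ≡⟨ cong ((a ++ 1b ∷ 0^ k) ⋆_) (⋆-split (x ++ 0b ∷ d) l E F) ⟨
    (a ++ 1b ∷ 0^ k) ⋆ (((x ++ 0b ∷ d) ++ 1b ∷ 0^ l) ⋆ (e ++ f))
      ≡⟨ cong (λ z → (a ++ 1b ∷ 0^ k) ⋆ (z ⋆ (e ++ f))) (++-assoc x (0b ∷ d) (1b ∷ 0^ l)) ⟩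
    (a ++ 1b ∷ 0^ k) ⋆ ((x ++ 0b ∷ d ++ 1b ∷ 0^ l) ⋆ (e ++ f)) ∎
    where
    assoc₁ : ∀ a n d m → a ++ x ++ n ++ d ++ m ≡ (a ++ x ++ n ++ d) ++ m
    assoc₁ a n d m = solve (++-monoid Bit)
    assoc₂ : ∀ a n d o m → ((a ++ x ++ n ++ d) ++ o) ++ e ++ m ++ f ≡
                           a ++ x ++ n ++ (d ++ o) ++ e ++ m ++ f
    assoc₂ a n d o m = solve (++-monoid Bit)
    assoc₃ : ∀ d o m → x ++ (d ++ o) ++ e ++ m ++ f ≡ ((x ++ d) ++ o) ++ e ++ m ++ f
    assoc₃ d o m = solve (++-monoid Bit)

M̄₁ : Monoid 0ℓ 0ℓ
M̄₁ = record
  { Carrier  = PseudoDyckPath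
  ; _≈_      = _≡_
  ; _∙_      = _∗_
  ; ε        = ε
  ; isMonoid = record
    { isSemigroup = record
      { isMagma = record { isEquivalence = isEquivalence ; ∙-cong = cong₂ _∗_ }
      ; assoc   = λ (u , p) (v , q) (w , r) → PseudoDyckPath-≡
          (⋆-assoc u v w (pseudo⇒walk p) (pseudo⇒walk q) (pseudo⇒walk r))
      }
    ; identity = (λ (v , _) → PseudoDyckPath-≡ (⋆-identityˡ v))
               , (λ (u , _) → PseudoDyckPath-≡ (⋆-identityʳ u))
    }
  }

------------------------------------------------------------------------
-- Free monoids

module _ {c ℓ x} (M : Monoid c ℓ) {X : Set x} where
  open Monoid M using (Carrier; _∙_; rawMonoid) renaming (ε to 1M)

  extend : (X → Carrier) → List X → Carrier
  extend g = foldr (λ x m → g x ∙ m) 1M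

  -- M is free on the family g when the homomorphism from the free monoid List X
  -- extending g is an isomorphism; in particular g is then injective, so this
  -- is freeness on the set of the g x.
  IsFreeOn : (X → Carrier) → Set _
  IsFreeOn g = IsMonoidIsomorphism (extend g)
    where open MonoidMorphisms (++-[]-rawMonoid X) rawMonoid

Generator : Set
Generator = DyckPath ⊎ ⊤

generator : Generator → PseudoDyckPath
generator (inj₁ (w , d)) = w ++ 1b ∷ 0b ∷ [] ,
  walk⇒pseudo (walk-++ (walk-lift 1 (dyck⇒walk d)) (up (down [])))
generator (inj₂ tt)      = 0b ∷ 1b ∷ [] , walk⇒pseudo (down (up []))

{-# OPTIONS --safe #-}
-- Since (0,1) ∗ v = (0,1,v) and (w,1,0) ∗ v = (w,1,v′,0,v″), where v = v′v″ as in
-- the definition of ∗, a non-empty pseudo-Dyck path p has exactly one left factor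
-- among the generators.  If p starts with 0 it is (0,1).  Otherwise p = p′p″ with
-- p′ a non-empty Dyck path, and p′ = (w,1,v′,0) is its decomposition at the last
-- visit to height 0 before its end.
module Submission where

open import Defs

open import Algebra.Bundles using (Monoid)
open import Algebra.Morphism.Structures using (module MonoidMorphisms)
open import Data.Empty using (⊥-elim)
open import Data.List.Base
  using (List; []; _∷_; [_]; _++_; _∷ʳ_; ++-[]-rawMonoid; length)
open import Data.List.Properties
  using (++-assoc; ++-monoid; length-++; ∷-injectiveʳ;
         ∷ʳ-injectiveˡ)
open import Data.Nat.Base using (ℕ; suc; _+_; _<_; _>_; s≤s; z≤n)
open import Data.Nat.Induction using (<-wellFounded)
open import Data.Nat.Properties using (m<n+m)
open import Data.Nat.Tactic.RingSolver using (solve-∀)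
open import Data.Product.Base using (_×_; _,_; ∃-syntax)
open import Data.Product.Properties using (,-injective)
open import Data.Sum.Base using (inj₁; inj₂)
open import Data.Unit.Base using (tt)
open import Function.Definitions using (Injective; Surjective)
open import Induction.WellFounded using (Acc; acc)
open import Relation.Binary.PropositionalEquality
  using (_≡_; _≢_; refl; sym; trans; cong; cong₂; subst; module ≡-Reasoning)
open import Tactic.MonoidSolver using (solve)

module _ {c ℓ x} (M : Monoid c ℓ) {X : Set x} where
  open Monoid M using (Carrier; _≈_; _∙_; rawMonoid; reflexive; identityˡ; assoc; ∙-congˡ)
    renaming (refl to ≈-refl; sym to ≈-sym; trans to ≈-trans)
  open MonoidMorphisms (++-[]-rawMonoid X) rawMonoid using (IsMonoidHomomorphism)

  extend-++ : ∀ (g : X → Carrier) xs ys →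
              extend M g (xs ++ ys) ≈ extend M g xs ∙ extend M g ys
  extend-++ g []       ys = ≈-sym (identityˡ _)
  extend-++ g (x ∷ xs) ys =
    ≈-trans (∙-congˡ (extend-++ g xs ys)) (≈-sym (assoc _ _ _))

  extend-isMonoidHomomorphism : ∀ (g : X → Carrier) → IsMonoidHomomorphism (extend M g)
  extend-isMonoidHomomorphism g = record
    { isMagmaHomomorphism = record
      { isRelHomomorphism = record { cong = λ e → reflexive (cong (extend M g) e) }
      ; homo              = extend-++ g
      }
    ; ε-homo = ≈-refl
    }

DyckPath-≡ : ∀ {p q : DyckPath} → DyckPath.word p ≡ DyckPath.word q → p ≡ q
DyckPath-≡ {w , p} {w , q} refl = cong (w ,_) (IsDyck-irrelevant p q)

-- The word fixes all height changes, so the two walks run in parallel, one unit apart.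
walk-end-suc : ∀ {i j k w} → Walk (suc i) w k → Walk i w j → k ≡ suc j
walk-end-suc []       []       = refl
walk-end-suc (up p)   (up q)   = walk-end-suc p q
walk-end-suc (down p) (down q) = walk-end-suc p q

-- The cut is at the last visit to 0 before the end; the start height is arbitrary so that recursion
-- on the walk works. In `above` there is no such visit: 0 is reached only by the final letter.
data LastReturn : ℕ → Word → Set where
  empty  : LastReturn 0 []
  above  : ∀ {i q} → Walk i q 0 → LastReturn (suc i) (q ∷ʳ 0b)
  return : ∀ {i w q} → Walk i w 0 → Walk 0 q 0 → LastReturn i (w ++ 1b ∷ q ∷ʳ 0b)

lastReturn : ∀ {i w} → Walk i w 0 → LastReturn i w
lastReturn [] = empty
lastReturn {i} (up p) with lastReturn p
-- From start height 0, the start itself is the last visit to 0.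
lastReturn {0}     (up p) | above q    = return [] q
lastReturn {suc i} (up p) | above q    = above (up q)
lastReturn         (up p) | return w q = return (up w) q
lastReturn (down p) with lastReturn p
... | empty      = above []
... | above q    = above (down q)
... | return w q = return (down w) q

-- Read from height 1, the left word reaches 0 only with its last letter, whereas on the right `w′`
-- reaches 0 before the end.
lastReturn-first : ∀ {q w′ q′} → Walk 0 q 0 → Walk 1 w′ 0 →
                   q ∷ʳ 0b ≢ w′ ++ 1b ∷ q′ ∷ʳ 0b
lastReturn-first {q = q} {w′} {q′} Q W e
  -- Without the final 0, `w′` is a prefix of `q`, so it stays nonnegative from height 0; from
  -- height 1 it then ends above 0.
  with refl ← ∷ʳ-injectiveˡ q (w′ ++ 1b ∷ q′) (trans e (sym (++-assoc w′ (1b ∷ q′) [ 0b ])))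
  with _ , V , _ ← walk-++⁻ w′ Q
  with () ← walk-end-suc W V

-- The two walks to the cut read the same letters until one stops. If the other goes on, it returns
-- to 0 inside an excursion that must stay above 0.
lastReturn-unique : ∀ {i w q w′ q′} → Walk i w 0 → Walk 0 q 0 → Walk i w′ 0 → Walk 0 q′ 0 →
                    w ++ 1b ∷ q ∷ʳ 0b ≡ w′ ++ 1b ∷ q′ ∷ʳ 0b → w ≡ w′ × q ≡ q′
lastReturn-unique {q = q} {q′ = q′} [] Q [] Q′ e = refl , ∷ʳ-injectiveˡ q q′ (∷-injectiveʳ e)
lastReturn-unique [] Q (up W′) Q′ e = ⊥-elim (lastReturn-first Q W′ (∷-injectiveʳ e))
lastReturn-unique (up W) Q [] Q′ e =
  ⊥-elim (lastReturn-first Q′ W (sym (∷-injectiveʳ e)))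
lastReturn-unique (up W) Q (up W′) Q′ e =
  let (a , b) = lastReturn-unique W Q W′ Q′ (∷-injectiveʳ e) in cong (1b ∷_) a , b
lastReturn-unique (down W) Q (down W′) Q′ e =
  let (a , b) = lastReturn-unique W Q W′ Q′ (∷-injectiveʳ e) in cong (0b ∷_) a , b
lastReturn-unique (up _) _ (down _) _ ()
lastReturn-unique (down _) _ (up _) _ ()

-- `⋆` only rearranges letters. Length thus serves as the measure for splitting off generators.
length-⋆ : ∀ u v → length (u ⋆ v) ≡ length u + length v
length-⋆ u v = let (a , k) = splitZeros u ; (b , c) = splitNonneg 0 v in begin
  length (a ++ b ++ 0^ k ++ c)
    ≡⟨ length-++ a ⟩
  length a + length (b ++ 0^ k ++ c)
    ≡⟨ cong (length a +_) (length-++ b) ⟩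
  length a + (length b + length (0^ k ++ c))
    ≡⟨ cong (λ n → length a + (length b + n)) (length-++ (0^ k)) ⟩
  length a + (length b + (length (0^ k) + length c))
    ≡⟨ shuffle (length a) (length b) (length (0^ k)) (length c) ⟩
  (length a + length (0^ k)) + (length b + length c)
    ≡⟨ cong₂ _+_ (length-++ a) (length-++ b) ⟨
  length (a ++ 0^ k) + length (b ++ c)
    ≡⟨ cong₂ (λ x y → length x + length y) (splitZeros-++ u) (splitNonneg-++ 0 v) ⟩
  length u + length v ∎
  where
  open ≡-Reasoning
  shuffle : ∀ a b k c → a + (b + (k + c)) ≡ (a + k) + (b + c)
  shuffle = solve-∀

infixr 7 _∷⋆_

_∷⋆_ : Generator → Word → Word
g ∷⋆ v = PseudoDyckPath.word (generator g) ⋆ v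

generator-nonempty : ∀ g → length (PseudoDyckPath.word (generator g)) > 0
generator-nonempty (inj₁ ([]    , _)) = s≤s z≤n
generator-nonempty (inj₁ (_ ∷ _ , _)) = s≤s z≤n
generator-nonempty (inj₂ tt)          = s≤s z≤n

∷⋆-shortens : ∀ g v → length v < length (g ∷⋆ v)
∷⋆-shortens g v =
  subst (length v <_) (sym (length-⋆ (PseudoDyckPath.word (generator g)) v))
    (m<n+m (length v) (generator-nonempty g))

∷⋆≢[] : ∀ g v → g ∷⋆ v ≢ []
∷⋆≢[] g v e with () ← subst (length v <_) (cong length e) (∷⋆-shortens g v)

dyck-∷⋆ : ∀ {w} (d : IsDyck w) {e f} → Walk 0 e 0 → StartsWithout1 f →
          inj₁ (w , d) ∷⋆ (e ++ f) ≡ (w ++ 1b ∷ e ∷ʳ 0b) ++ f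
-- The word of the generator ends in exactly one 0, hence the exponent 1.
dyck-∷⋆ {w} d {e} {f} E F = trans (⋆-split w 1 E F) (assoc [ 1b ] [ 0b ])
  where
  assoc : ∀ o z → (w ++ o) ++ e ++ z ++ f ≡ (w ++ o ++ e ++ z) ++ f
  assoc o z = solve (++-monoid Bit)

01-∷⋆ : ∀ v → inj₂ tt ∷⋆ v ≡ 0b ∷ 1b ∷ v
01-∷⋆ v = cong (λ z → 0b ∷ 1b ∷ z) (splitNonneg-++ 0 v)

data LeftFactor : Word → Set where
  []  : LeftFactor []
  _∷_ : ∀ g {v} → Walk 1 v 1 → LeftFactor (g ∷⋆ v)

leftFactor : ∀ {p} → Walk 1 p 1 → LeftFactor p
leftFactor P with rightView P
... | split D S B with lastReturn D
-- Dropping `w` and the pair 1, 0 around `q` from the Dyck prefix leaves the cofactor: `q`, then the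
-- rest.
...   | return W Q =
        subst LeftFactor (dyck-∷⋆ (walk⇒dyck W) Q S)
          (inj₁ (_ , walk⇒dyck W) ∷ walk-++ (walk-lift 1 Q) B)
leftFactor P | split _ S []            | empty = []
-- After the initial 0 the walk is at height 0 and must still end at 1, so the next letter is 1.
leftFactor P | split _ S (down (up B)) | empty = subst LeftFactor (01-∷⋆ _) (inj₂ tt ∷ B)

-- The left word begins with a non-empty Dyck path, hence with 1; the right one begins with 0.
dyck-∷⋆≢01-∷⋆ : ∀ {w} (d : IsDyck w) {u} v → Walk 1 u 1 →
                  inj₁ (w , d) ∷⋆ u ≢ inj₂ tt ∷⋆ v
dyck-∷⋆≢01-∷⋆ {w} d v U e with rightView U
... | split {a} {b} A S _ =
      clash (dyck⇒walk d) (trans (sym (dyck-∷⋆ d A S)) (trans e (01-∷⋆ v)))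
  where
  clash : ∀ {w a b v} → Walk 0 w 0 → (w ++ 1b ∷ a) ++ b ≢ 0b ∷ v
  clash [] ()
  clash (up _) ()

∷⋆-injective : ∀ g h {u v} → Walk 1 u 1 → Walk 1 v 1 → g ∷⋆ u ≡ h ∷⋆ v → g ≡ h × u ≡ v
∷⋆-injective (inj₁ (w , d)) (inj₁ (w′ , d′)) U V e with rightView U | rightView V
... | split {a} {b} A S _ | split {a′} {b′} A′ S′ _ =
  let W          = dyck⇒walk d
      W′         = dyck⇒walk d′
      -- `splitNonneg 0` recovers the Dyck prefix and the remainder from each side; the last return
      -- then separates `w` from `a`.
      (eq₁ , eq₂) = ,-injective (trans (sym (splitNonneg-unique (closed W A) S))
                     (trans (cong (splitNonneg 0)
                        (trans (sym (dyck-∷⋆ d A S)) (trans e (dyck-∷⋆ d′ A′ S′))))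
                     (splitNonneg-unique (closed W′ A′) S′)))
      (w≡ , a≡)  = lastReturn-unique W A W′ A′ eq₁
  in cong inj₁ (DyckPath-≡ w≡) , cong₂ _++_ a≡ eq₂
  where
  closed : ∀ {w a} → Walk 0 w 0 → Walk 0 a 0 → Walk 0 (w ++ 1b ∷ a ∷ʳ 0b) 0
  closed W A = walk-++ W (up (walk-++ (walk-lift 1 A) (down [])))
∷⋆-injective (inj₁ (_ , d)) (inj₂ tt) {v = v} U V e = ⊥-elim (dyck-∷⋆≢01-∷⋆ d v U e)
∷⋆-injective (inj₂ tt) (inj₁ (_ , d)) {u} U V e = ⊥-elim (dyck-∷⋆≢01-∷⋆ d u V (sym e))
∷⋆-injective (inj₂ tt) (inj₂ tt) {u} {v} U V e =
  refl , ∷-injectiveʳ (∷-injectiveʳ (trans (sym (01-∷⋆ u)) (trans e (01-∷⋆ v))))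

product : List Generator → PseudoDyckPath
product = extend M̄₁ generator

-- Cancelling first generators by `∷⋆-injective` reads the list off its product.
product-injective : Injective _≡_ _≡_ product
product-injective {xs} {ys} e = go xs ys (cong PseudoDyckPath.word e)
  where
  word : List Generator → Word
  word xs = PseudoDyckPath.word (product xs)
  walk : ∀ xs → Walk 1 (word xs) 1
  walk xs = pseudo⇒walk (PseudoDyckPath.isPseudoDyck (product xs))
  go : ∀ xs ys → word xs ≡ word ys → xs ≡ ys
  go []       []       e = refl
  go []       (h ∷ ys) e = ⊥-elim (∷⋆≢[] h (word ys) (sym e))
  go (g ∷ xs) []       e = ⊥-elim (∷⋆≢[] g (word xs) e)
  go (g ∷ xs) (h ∷ ys) e =
    let (g≡h , e′) = ∷⋆-injective g h (walk xs) (walk ys) e in cong₂ _∷_ g≡h (go xs ys e′)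

-- The cofactor is shorter than `w` but no structural part of it, hence the accessibility argument.
factorise : ∀ {w} → Acc _<_ (length w) → Walk 1 w 1 →
            ∃[ xs ] PseudoDyckPath.word (product xs) ≡ w
factorise (acc rs) W with leftFactor W
... | []        = [] , refl
... | _∷_ g {v} V =
  let (xs , e) = factorise (rs (∷⋆-shortens g v)) V in g ∷ xs , cong (g ∷⋆_) e

product-surjective : Surjective _≡_ _≡_ product
product-surjective (w , p) =
  let (xs , e) = factorise (<-wellFounded (length w)) (pseudo⇒walk p) in
  -- Surjectivity is asked for every list equal to the preimage, hence the match on `refl`.
  xs , λ { refl → PseudoDyckPath-≡ e }

proposition2p6 : IsFreeOn M̄₁ generator
proposition2p6 = record
  { isMonoidMonomorphism = record
    { isMonoidHomomorphism = extend-isMonoidHomomorphism M̄₁ generator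
    ; injective            = product-injective
    }
  ; surjective = product-surjective
  }
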